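{- (i) There exist syntactic protocols $P,Q$ with $Q\subseteq P$ such that $Q^\blacksquare\not\subseteq P^\blacksquare$; (ii) there exist syntactic protocols $P,Q$ with $Q\subseteq P$ such that $Q^\square\not\subseteq P^\square$. That is, neither hard look-ahead strengthening nor hard one-step strengthening is monotone.
   Context: Let $A$ be a finite set of agents. A gossip graph is $G=(A,N,S)$ with $N,S\subseteq A\times A$ and $I\subseteq S\subseteq N$; $N_ab$: $a$ knows $b$'s number, $S_ab$: $a$ knows $b$'s secret; $G$ is initial if $S=I$. A call $ab$ ($a\neq b$) is possible iff $N_ab$; executing it gives both $a$ and $b$ the union of their numbers and secrets (others unchanged); $G^\sigma=(A,N^\sigma,S^\sigma)$ results from executing $\sigma$. A gossip state is $(G,\sigma)$ with $G$ initial and $\sigma$ a sequence of calls each possible when made. Formulas $\phi::=\top\mid N_ab\mid S_ab\mid\neg\phi\mid\phi\wedge\phi\mid K_a^P\phi\mid[\pi]\phi$, programs $\pi::=?\phi\mid ab\mid\pi;\pi\mid\pi\cup\pi\mid\pi^*$; $\mathit{Ex}:=\bigwedge_{a,b}S_ab$; $\langle\pi\rangle=\neg[\pi]\neg$. A syntactic protocol $P$ is given by protocol conditions $P_{ab}$ (formulas, $a\neq b$); as a program $P=(\bigcup_{a\neq b}(?(N_ab\wedge P_{ab});ab))^*;?\bigwedge_{a\neq b}\neg(N_ab\wedge P_{ab})$. Semantics: atoms via $N^\sigma,S^\sigma$; $K_a^P\phi$ true at $(G,\sigma)$ iff $\phi$ true at all $(G,\sigma')\sim_a^P(G,\sigma)$;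 $[\pi]\phi$ standard, the call $ab$ leading to $(G,\sigma;ab)$ iff $N^\sigma_ab$. $ab$ is $P$-permitted at $(G,\sigma)$ iff $G,\sigma\models N_ab\wedge P_{ab}$; $P(G)$ is the set of sequences built from $\epsilon$ by appending $P$-permitted calls; $Q\subseteq P$ means $Q(G)\subseteq P(G)$ for all initial $G$. Epistemic relation $\sim_a^P$: (1) $(G,\epsilon)\sim_a^P(G,\epsilon)$; (2) if $(G,\sigma)\sim_a^P(G,\tau)$, $N^\sigma_b=N^\tau_b$, $S^\sigma_b=S^\tau_b$ and $ab$ is $P$-permitted at both, then $(G,\sigma;ab)\sim_a^P(G,\tau;ab)$, likewise for $ba$; (3) if $(G,\sigma)\sim_a^P(G,\tau)$, $c,d,e,f\neq a$, $cd$ $P$-permitted at $(G,\sigma)$, $ef$ at $(G,\tau)$, then $(G,\sigma;cd)\sim_a^P(G,\tau;ef)$. Hard look-ahead strengthening: $P^\blacksquare_{ab}:=P_{ab}\wedge K_a^P[ab]\langle P\rangle\mathit{Ex}$. Hard one-step strengthening: $P^\square_{ab}:=P_{ab}\wedge K_a^P[ab](\mathit{Ex}\vee\bigvee_{i,j}(N_ij\wedge P_{ij}))$. -}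

module Defs where

open import Data.Nat using (ℕ)
open import Data.Fin using (Fin; _≟_)
open import Data.Bool using (Bool; true; false; _∨_; if_then_else_)
open import Data.List using (List; []; _∷_; concatMap; map; foldr; allFin)
open import Data.Product using (Σ; ∃; _×_; _,_)
open import Data.Sum using (_⊎_)
open import Data.Unit using (⊤)
open import Relation.Nullary using (¬_; does)
open import Relation.Binary.PropositionalEquality using (_≡_; _≢_)
open import Relation.Binary.Construct.Closure.ReflexiveTransitive using (Star)

Rel₂ : ℕ → Set
Rel₂ n = Fin n → Fin n → Bool

record Graph (n : ℕ) : Set where
  field
    Nr : Rel₂ n
    Sr : Rel₂ n
open Graph public

-- An initial gossip graph: S = I ⊆ N.  It is determined by N (reflexive).
record InitGraph (n : ℕ) : Set where
  field
    nums   : Rel₂ n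
    nums-refl : ∀ a → nums a a ≡ true
open InitGraph public

initial : ∀ {n} → InitGraph n → Graph n
initial G = record { Nr = nums G ; Sr = λ a b → does (a ≟ b) }

callG : ∀ {n} → Fin n → Fin n → Graph n → Graph n
callG {n} a b G = record { Nr = upd (Nr G) ; Sr = upd (Sr G) }
  where
  upd : Rel₂ n → Rel₂ n
  upd R x y = if (does (x ≟ a) ∨ does (x ≟ b)) then (R a y ∨ R b y) else R x y

Call : ℕ → Set
Call n = Fin n × Fin n

data Seq (n : ℕ) : Set where
  ε   : Seq n
  _▷_ : Seq n → Call n → Seq n

exec : ∀ {n} → Graph n → Seq n → Graph n
exec G ε = G
exec G (σ ▷ (a , b)) = callG a b (exec G σ)

Nσ : ∀ {n} → InitGraph n → Seq n → Fin n → Fin n → Set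
Nσ G σ a b = Nr (exec (initial G) σ) a b ≡ true

Sσ : ∀ {n} → InitGraph n → Seq n → Fin n → Fin n → Set
Sσ G σ a b = Sr (exec (initial G) σ) a b ≡ true

infixr 6 _∧'_
infixr 5 _⨾_
infixr 4 _∪'_

-- Formulas and programs.  K' a P φ is K_a^P φ, where P is a protocol
-- given by its protocol conditions P a b (only used for a ≢ b).
mutual
  data Form (n : ℕ) : Set where
    ⊤'   : Form n
    N'   : Fin n → Fin n → Form n
    S'   : Fin n → Fin n → Form n
    ¬'_  : Form n → Form n
    _∧'_ : Form n → Form n → Form n
    K'   : Fin n → (Fin n → Fin n → Form n) → Form n → Form n
    [_]_ : Prog n → Form n → Form n

  data Prog (n : ℕ) : Set where
    ¿_    : Form n → Prog n
    call' : Fin n → Fin n → Prog n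
    _⨾_   : Prog n → Prog n → Prog n
    _∪'_  : Prog n → Prog n → Prog n
    _*'   : Prog n → Prog n

Protocol : ℕ → Set
Protocol n = Fin n → Fin n → Form n

PermittedWith : ∀ {n} → InitGraph n → Seq n → Fin n → Fin n → Set → Set
PermittedWith G σ a b X = (a ≢ b) × Nσ G σ a b × X

data Sim {n : ℕ} (G : InitGraph n) (perm : Seq n → Fin n → Fin n → Set)
         (a : Fin n) : Seq n → Seq n → Set where
  base  : Sim G perm a ε ε
  withL : ∀ {σ τ b} → Sim G perm a σ τ
        → (∀ x → Nr (exec (initial G) σ) b x ≡ Nr (exec (initial G) τ) b x)
        → (∀ x → Sr (exec (initial G) σ) b x ≡ Sr (exec (initial G) τ) b x)
        → perm σ a b → perm τ a b
        → Sim G perm a (σ ▷ (a , b)) (τ ▷ (a , b))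
  withR : ∀ {σ τ b} → Sim G perm a σ τ
        → (∀ x → Nr (exec (initial G) σ) b x ≡ Nr (exec (initial G) τ) b x)
        → (∀ x → Sr (exec (initial G) σ) b x ≡ Sr (exec (initial G) τ) b x)
        → perm σ b a → perm τ b a
        → Sim G perm a (σ ▷ (b , a)) (τ ▷ (b , a))
  other : ∀ {σ τ c d e f} → Sim G perm a σ τ
        → c ≢ a → d ≢ a → e ≢ a → f ≢ a
        → perm σ c d → perm τ e f
        → Sim G perm a (σ ▷ (c , d)) (τ ▷ (e , f))

mutual
  ⟦_⟧ : ∀ {n} → Form n → InitGraph n → Seq n → Set
  ⟦ ⊤' ⟧ G σ = ⊤
  ⟦ N' a b ⟧ G σ = Nσ G σ a b
  ⟦ S' a b ⟧ G σ = Sσ G σ a b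
  ⟦ ¬' φ ⟧ G σ = ¬ ⟦ φ ⟧ G σ
  ⟦ φ ∧' ψ ⟧ G σ = ⟦ φ ⟧ G σ × ⟦ ψ ⟧ G σ
  ⟦ K' a P φ ⟧ G σ =
    ∀ τ → Sim G (λ ρ c d → PermittedWith G ρ c d (⟦ P c d ⟧ G ρ)) a σ τ → ⟦ φ ⟧ G τ
  ⟦ [ π ] φ ⟧ G σ = ∀ τ → ⟦ π ⟧ₚ G σ τ → ⟦ φ ⟧ G τ

  ⟦_⟧ₚ : ∀ {n} → Prog n → InitGraph n → Seq n → Seq n → Set
  ⟦ ¿ ψ ⟧ₚ G σ τ = (σ ≡ τ) × ⟦ ψ ⟧ G σ
  ⟦ call' a b ⟧ₚ G σ τ = (a ≢ b) × Nσ G σ a b × (τ ≡ σ ▷ (a , b))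
  ⟦ π ⨾ π' ⟧ₚ G σ τ = ∃ λ ρ → ⟦ π ⟧ₚ G σ ρ × ⟦ π' ⟧ₚ G ρ τ
  ⟦ π ∪' π' ⟧ₚ G σ τ = ⟦ π ⟧ₚ G σ τ ⊎ ⟦ π' ⟧ₚ G σ τ
  ⟦ π *' ⟧ₚ G σ τ = Star (⟦ π ⟧ₚ G) σ τ

_∨'_ : ∀ {n} → Form n → Form n → Form n
φ ∨' ψ = ¬' ((¬' φ) ∧' (¬' ψ))

⟨_⟩_ : ∀ {n} → Prog n → Form n → Form n
⟨ π ⟩ φ = ¬' ([ π ] (¬' φ))

⋀ : ∀ {n} → List (Form n) → Form n
⋀ = foldr _∧'_ ⊤'

⋁ : ∀ {n} → List (Form n) → Form n
⋁ = foldr _∨'_ (¬' ⊤')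

⋃ : ∀ {n} → List (Prog n) → Prog n
⋃ = foldr _∪'_ (¿ (¬' ⊤'))

pairs : ∀ n → List (Call n)
pairs n = concatMap (λ a → concatMap (λ b → if does (a ≟ b) then [] else ((a , b) ∷ [])) (allFin n)) (allFin n)

Ex : ∀ {n} → Form n
Ex {n} = ⋀ (concatMap (λ a → map (λ b → S' a b) (allFin n)) (allFin n))

toProg : ∀ {n} → Protocol n → Prog n
toProg {n} P =
  ((⋃ (map (λ { (a , b) → (¿ (N' a b ∧' P a b)) ⨾ call' a b }) (pairs n))) *')
  ⨾ (¿ (⋀ (map (λ { (a , b) → ¬' (N' a b ∧' P a b) }) (pairs n))))

Permitted : ∀ {n} → Protocol n → InitGraph n → Seq n → Fin n → Fin n → Set
Permitted P G σ a b = PermittedWith G σ a b (⟦ P a b ⟧ G σ)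

data Reach {n : ℕ} (P : Protocol n) (G : InitGraph n) : Seq n → Set where
  nil  : Reach P G ε
  snoc : ∀ {σ a b} → Reach P G σ → Permitted P G σ a b → Reach P G (σ ▷ (a , b))

_⊆ₚ_ : ∀ {n} → Protocol n → Protocol n → Set
Q ⊆ₚ P = ∀ G σ → Reach Q G σ → Reach P G σ

hardLA : ∀ {n} → Protocol n → Protocol n
hardLA P a b = P a b ∧' K' a P ([ call' a b ] (⟨ toProg P ⟩ Ex))

hardOS : ∀ {n} → Protocol n → Protocol n
hardOS {n} P a b = P a b ∧' K' a P ([ call' a b ]
  (Ex ∨' ⋁ (map (λ { (i , j) → N' i j ∧' P i j }) (pairs n))))

-- Both strengthenings quantify over what the caller considers possible relative to the
-- protocol itself, so passing to a subprotocol changes both the caller's uncertainty and which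
-- continuations are available; neither change need preserve the strengthened condition.
--
-- (i) Two agents who know each other's number.  Under "always call" a call is permitted in
-- every state, so the protocol, read as a program, never terminates and ⟨P⟩Ex is false
-- everywhere: its look-ahead strengthening permits nothing.  "Learn new secrets" terminates
-- with both agents expert after the call 01, which its strengthening therefore permits.
--
-- (ii) Four agents; 0 knows the number of 1, agent 1 those of 2 and 3, and 2 that of 3.
-- P allows 12 and 13 while 1 knows no other secret, 01 while 0 does not know the secret of 1,
-- and 23 once 2 knows the secret of 1; Q is P without 13.  After 12, agent 0 considers 13
-- possible under P, and after 13;01 no P-call is permitted although 0 does not know the secret
-- of 2, so the one-step strengthening of P forbids 01 there.  Under Q, agent 0 knows that 12
-- happened, and after 12;01 the call 23 is permitted.

module Submission where

open import Defs
open import Data.Nat using (ℕ)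
open import Data.Fin using (Fin; zero; suc; _≟_)
open import Data.Bool using (Bool; true; false; _∧_; if_then_else_)
open import Data.Bool.Properties using (if-eta)
open import Data.Empty using (⊥-elim)
open import Data.Unit using (tt)
open import Data.Product using (Σ; ∃₂; _×_; _,_; proj₁; proj₂)
open import Data.List using (List; []; _∷_; allFin)
open import Data.List.Relation.Unary.All using (All; []; _∷_; tabulate)
open import Data.List.Relation.Unary.All.Properties using (map⁺; concat⁺; tabulate⁺)
open import Data.List.Relation.Unary.Any using (here; there; satisfied)
open import Data.List.Membership.Propositional using (_∈_; lose)
open import Data.List.Membership.Propositional.Properties
  using (∈-map⁺; ∈-concatMap⁺; ∈-concatMap⁻; ∈-allFin)
open import Relation.Nullary using (¬_; yes; no; does; contradiction)
open import Relation.Binary.PropositionalEquality using (_≡_; _≢_; refl; cong)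
import Relation.Binary.Construct.Closure.ReflexiveTransitive as Star

private variable
  n : ℕ
  G : InitGraph n
  σ τ : Seq n
  a b : Fin n
  φ : Form n
  l : List (Form n)
  P Q : Protocol n

⋀⁻ : φ ∈ l → ⟦ ⋀ l ⟧ G σ → ⟦ φ ⟧ G σ
⋀⁻ (here refl)  (x , _)  = x
⋀⁻ (there φ∈l) (_ , xs) = ⋀⁻ φ∈l xs

⋀⁺ : All (λ ψ → ⟦ ψ ⟧ G σ) l → ⟦ ⋀ l ⟧ G σ
⋀⁺ []       = tt
⋀⁺ (x ∷ xs) = x , ⋀⁺ xs

⋁⁺ : φ ∈ l → ⟦ φ ⟧ G σ → ⟦ ⋁ l ⟧ G σ
⋁⁺ (here refl)  x (¬x , _)  = ¬x x
⋁⁺ (there φ∈l) x (_ , ¬xs) = ¬xs (⋁⁺ φ∈l x)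

¬⋁ : All (λ ψ → ¬ ⟦ ψ ⟧ G σ) l → ¬ ⟦ ⋁ l ⟧ G σ
¬⋁ []          none = none tt
¬⋁ (¬x ∷ ¬xs) none = none (¬x , ¬⋁ ¬xs)

Ex⁻ : ⟦ Ex ⟧ G σ → ∀ a b → Sσ G σ a b
Ex⁻ ex a b = ⋀⁻ (∈-concatMap⁺ _ (lose (∈-allFin a) (∈-map⁺ (S' a) (∈-allFin b)))) ex

Ex⁺ : (∀ a b → Sσ G σ a b) → ⟦ Ex ⟧ G σ
Ex⁺ s = ⋀⁺ (concat⁺ (map⁺ (tabulate⁺ λ a → map⁺ (tabulate⁺ λ b → s a b))))

∈-pairs⁺ : a ≢ b → (a , b) ∈ pairs n
∈-pairs⁺ {a = a} {b = b} a≢b =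
  ∈-concatMap⁺ _ (lose (∈-allFin a) (∈-concatMap⁺ _ (lose (∈-allFin b) distinct)))
  where
  distinct : (a , b) ∈ (if does (a ≟ b) then [] else ((a , b) ∷ []))
  distinct with a ≟ b
  ... | yes a≡b = contradiction a≡b a≢b
  ... | no _    = here refl

∈-pairs⁻ : (a , b) ∈ pairs n → a ≢ b
∈-pairs⁻ {n = n} ab∈ with satisfied (∈-concatMap⁻ _ {allFin n} ab∈)
... | x , ab∈x with satisfied (∈-concatMap⁻ _ {allFin n} ab∈x)
... | y , ab∈xy = distinct ab∈xy
  where
  distinct : (a , b) ∈ (if does (x ≟ y) then [] else ((x , y) ∷ [])) → a ≢ b
  distinct with x ≟ y
  ... | yes _   = λ ()
  ... | no x≢y = λ { (here refl) → x≢y }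

Indist : Protocol n → InitGraph n → Fin n → Seq n → Seq n → Set
Indist P G = Sim G (Permitted P G)

Terminal : Protocol n → InitGraph n → Seq n → Set
Terminal P G σ = ∀ a b → ¬ Permitted P G σ a b

⊆ₚ-pointwise : (∀ G σ a b → ⟦ Q a b ⟧ G σ → ⟦ P a b ⟧ G σ) → Q ⊆ₚ P
⊆ₚ-pointwise Q⇒P G ε        nil = nil
⊆ₚ-pointwise Q⇒P G (σ ▷ _) (snoc r (a≢b , nab , q)) =
  snoc (⊆ₚ-pointwise Q⇒P G σ r) (a≢b , nab , Q⇒P G σ _ _ q)

¬⊆ₚ-witness : Reach Q G (σ ▷ (a , b)) → ¬ ⟦ P a b ⟧ G σ → ¬ (Q ⊆ₚ P)
¬⊆ₚ-witness {G = G} r ¬p Q⊆P with Q⊆P G _ r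
... | snoc _ (_ , _ , p) = ¬p p

terminal-All : Terminal P G σ
             → All (λ x → ¬ (Nσ G σ (proj₁ x) (proj₂ x) × ⟦ P (proj₁ x) (proj₂ x) ⟧ G σ)) (pairs n)
terminal-All t = tabulate λ x∈ (nab , p) → t _ _ (∈-pairs⁻ x∈ , nab , p)

toProg-terminal : ⟦ toProg P ⟧ₚ G σ τ → Terminal P G τ
toProg-terminal (_ , _ , refl , stuck) a b (a≢b , nab , p) =
  ⋀⁻ (∈-map⁺ _ (∈-pairs⁺ a≢b)) stuck (nab , p)

terminal-toProg : Terminal P G σ → ⟦ toProg P ⟧ₚ G σ σ
terminal-toProg t = _ , Star.ε , refl , ⋀⁺ (map⁺ (terminal-All t))

⟨toProg⟩-terminal : Terminal P G σ → ⟦ φ ⟧ G σ → ⟦ ⟨ toProg P ⟩ φ ⟧ G σ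
⟨toProg⟩-terminal t x never = never _ (terminal-toProg t) x

¬⟨toProg⟩-alwaysPermitted : (∀ τ → Permitted P G τ a b) → ¬ ⟦ ⟨ toProg P ⟩ φ ⟧ G σ
¬⟨toProg⟩-alwaysPermitted {a = a} {b = b} perm never =
  never λ τ run _ → toProg-terminal run a b (perm τ)

hardOS⁺ : ⟦ P a b ⟧ G σ
        → (∀ τ → Indist P G a σ τ → Nσ G τ a b → ∃₂ λ i j → Permitted P G (τ ▷ (a , b)) i j)
        → ⟦ hardOS P a b ⟧ G σ
hardOS⁺ p next = p , λ where
  τ τ∼σ _ (_ , nab , refl) (_ , ¬some) →
    let (i , j , i≢j , nij , pij) = next τ τ∼σ nab
    in ¬some (⋁⁺ (∈-map⁺ _ (∈-pairs⁺ i≢j)) (nij , pij))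

¬hardOS : ∀ {c d} → Indist P G a σ τ → a ≢ b → Nσ G τ a b
        → ¬ Sσ G (τ ▷ (a , b)) c d → Terminal P G (τ ▷ (a , b)) → ¬ ⟦ hardOS P a b ⟧ G σ
¬hardOS {c = c} {d} τ∼σ a≢b nab ¬scd t (_ , k) =
  k _ τ∼σ _ (a≢b , nab , refl) ((λ ex → ¬scd (Ex⁻ ex c d)) , ¬⋁ (map⁺ (terminal-All t)))

pattern a₀ = zero
pattern a₁ = suc zero
pattern a₂ = suc (suc zero)
pattern a₃ = suc (suc (suc zero))

complete : InitGraph n
complete = record { nums = λ _ _ → true ; nums-refl = λ _ → refl }

complete-N : ∀ σ a b → Nσ (complete {n}) σ a b
complete-N ε              a b = refl
complete-N (σ ▷ (c , d)) a b rewrite complete-N σ c b | complete-N σ a b = if-eta _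

callAlways : Protocol n
callAlways _ _ = ⊤'

learnNewSecrets : Protocol n
learnNewSecrets a b = ¬' S' a b

learnNewSecrets-hardLA : ⟦ hardLA learnNewSecrets a₀ a₁ ⟧ complete (ε {2})
learnNewSecrets-hardLA = (λ ()) , λ where
    .ε base _ (_ , _ , refl) →
      ⟨toProg⟩-terminal {P = learnNewSecrets} {G = complete} {φ = Ex} terminal
        (Ex⁺ {G = complete} {σ = ε ▷ (a₀ , a₁)} informed)
  where
  informed : ∀ a b → Sσ (complete {2}) (ε ▷ (a₀ , a₁)) a b
  informed a₀ a₀ = refl
  informed a₀ a₁ = refl
  informed a₁ a₀ = refl
  informed a₁ a₁ = refl

  terminal : Terminal learnNewSecrets complete (ε ▷ (a₀ , a₁))
  terminal a b (_ , _ , ¬s) = ¬s (informed a b)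

¬callAlways-hardLA : ¬ ⟦ hardLA callAlways a₀ a₁ ⟧ complete (ε {2})
¬callAlways-hardLA (_ , k) =
  ¬⟨toProg⟩-alwaysPermitted {P = callAlways} {G = complete} {φ = Ex}
    (λ τ → (λ ()) , complete-N τ a₀ a₁ , tt)
    (k ε base _ ((λ ()) , refl , refl))

hardLA-nonMonotone : (learnNewSecrets {2} ⊆ₚ callAlways)
                   × ¬ (hardLA learnNewSecrets ⊆ₚ hardLA callAlways)
hardLA-nonMonotone =
  ⊆ₚ-pointwise (λ _ _ _ _ _ → tt) ,
  ¬⊆ₚ-witness (snoc nil ((λ ()) , refl , learnNewSecrets-hardLA)) ¬callAlways-hardLA

_without_ : Protocol n → Call n → Protocol n
(P without (c , d)) a b = if does (a ≟ c) ∧ does (b ≟ d) then ¬' ⊤' else P a b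

without-⊆ₚ : ∀ {c} → (P without c) ⊆ₚ P
without-⊆ₚ = ⊆ₚ-pointwise λ _ _ _ _ → drop _
  where
  drop : ∀ {ψ : Form n} {G σ} x → ⟦ if x then ¬' ⊤' else ψ ⟧ G σ → ⟦ ψ ⟧ G σ
  drop true  forbidden = ⊥-elim (forbidden tt)
  drop false allowed   = allowed

numbers₄ : Fin 4 → Fin 4 → Bool
numbers₄ a₀ a₀ = true
numbers₄ a₀ a₁ = true
numbers₄ a₁ a₁ = true
numbers₄ a₁ a₂ = true
numbers₄ a₁ a₃ = true
numbers₄ a₂ a₂ = true
numbers₄ a₂ a₃ = true
numbers₄ a₃ a₃ = true
numbers₄ _  _  = false

G₄ : InitGraph 4
G₄ = record { nums = numbers₄ ; nums-refl = λ { a₀ → refl ; a₁ → refl ; a₂ → refl ; a₃ → refl } }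

onlyOwnSecret₁ : Form 4
onlyOwnSecret₁ = (¬' S' a₁ a₀) ∧' (¬' S' a₁ a₂) ∧' (¬' S' a₁ a₃)

P₄ : Protocol 4
P₄ a₀ a₁ = ¬' S' a₀ a₁
P₄ a₁ a₂ = onlyOwnSecret₁
P₄ a₁ a₃ = onlyOwnSecret₁
P₄ a₂ a₃ = S' a₂ a₁
P₄ _  _  = ¬' ⊤'

Q₄ : Protocol 4
Q₄ = P₄ without (a₁ , a₃)

onlyOwnSecret₁-initially : ⟦ onlyOwnSecret₁ ⟧ G₄ ε
onlyOwnSecret₁-initially = (λ ()) , (λ ()) , (λ ())

Q₄-hardOS-12 : ⟦ hardOS Q₄ a₁ a₂ ⟧ G₄ ε
Q₄-hardOS-12 = hardOS⁺ onlyOwnSecret₁-initially λ where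
  .ε base _ → a₀ , a₁ , (λ ()) , refl , (λ ())

Q₄-onlyCall12 : ∀ {c d} → Permitted Q₄ G₄ ε c d → c ≢ a₀ → d ≢ a₀ → (c , d) ≡ (a₁ , a₂)
Q₄-onlyCall12 {a₀} {_}  _ c≢a₀ _ = contradiction refl c≢a₀
Q₄-onlyCall12 {_}  {a₀} _ _ d≢a₀ = contradiction refl d≢a₀
Q₄-onlyCall12 {a₁} {a₁} (c≢d , _) _ _ = contradiction refl c≢d
Q₄-onlyCall12 {a₁} {a₂} _ _ _ = refl
Q₄-onlyCall12 {a₁} {a₃} (_ , _ , forbidden) _ _ = ⊥-elim (forbidden tt)
Q₄-onlyCall12 {a₂} {a₁} (_ , () , _) _ _
Q₄-onlyCall12 {a₂} {a₂} (c≢d , _) _ _ = contradiction refl c≢d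
Q₄-onlyCall12 {a₂} {a₃} (_ , _ , ()) _ _
Q₄-onlyCall12 {a₃} {a₁} (_ , () , _) _ _
Q₄-onlyCall12 {a₃} {a₂} (_ , () , _) _ _
Q₄-onlyCall12 {a₃} {a₃} (c≢d , _) _ _ = contradiction refl c≢d

Q₄-indist : Indist Q₄ G₄ a₀ (ε ▷ (a₁ , a₂)) τ → τ ≡ ε ▷ (a₁ , a₂)
Q₄-indist (other base _ _ c≢a₀ d≢a₀ _ perm) = cong (ε ▷_) (Q₄-onlyCall12 perm c≢a₀ d≢a₀)

Q₄-hardOS-01 : ⟦ hardOS Q₄ a₀ a₁ ⟧ G₄ (ε ▷ (a₁ , a₂))
Q₄-hardOS-01 = hardOS⁺ (λ ()) next
  where
  next : ∀ τ → Indist Q₄ G₄ a₀ (ε ▷ (a₁ , a₂)) τ → Nσ G₄ τ a₀ a₁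
       → ∃₂ λ i j → Permitted Q₄ G₄ (τ ▷ (a₀ , a₁)) i j
  next τ τ∼ _ rewrite Q₄-indist τ∼ = a₂ , a₃ , (λ ()) , refl , refl

P₄-indist : Indist P₄ G₄ a₀ (ε ▷ (a₁ , a₂)) (ε ▷ (a₁ , a₃))
P₄-indist = other base (λ ()) (λ ()) (λ ()) (λ ())
  ((λ ()) , refl , onlyOwnSecret₁-initially) ((λ ()) , refl , onlyOwnSecret₁-initially)

P₄-terminal : Terminal P₄ G₄ ((ε ▷ (a₁ , a₃)) ▷ (a₀ , a₁))
P₄-terminal a₀ a₁ (_ , _ , ¬s) = ¬s refl
P₄-terminal a₁ a₂ (_ , _ , ¬s , _) = ¬s refl
P₄-terminal a₁ a₃ (_ , _ , ¬s , _) = ¬s refl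
P₄-terminal a₂ a₃ (_ , _ , ())
P₄-terminal a₀ a₀ (_ , _ , forbidden) = forbidden tt
P₄-terminal a₀ a₂ (_ , _ , forbidden) = forbidden tt
P₄-terminal a₀ a₃ (_ , _ , forbidden) = forbidden tt
P₄-terminal a₁ a₀ (_ , _ , forbidden) = forbidden tt
P₄-terminal a₁ a₁ (_ , _ , forbidden) = forbidden tt
P₄-terminal a₂ a₀ (_ , _ , forbidden) = forbidden tt
P₄-terminal a₂ a₁ (_ , _ , forbidden) = forbidden tt
P₄-terminal a₂ a₂ (_ , _ , forbidden) = forbidden tt
P₄-terminal a₃ a₀ (_ , _ , forbidden) = forbidden tt
P₄-terminal a₃ a₁ (_ , _ , forbidden) = forbidden tt
P₄-terminal a₃ a₂ (_ , _ , forbidden) = forbidden tt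
P₄-terminal a₃ a₃ (_ , _ , forbidden) = forbidden tt

¬P₄-hardOS-01 : ¬ ⟦ hardOS P₄ a₀ a₁ ⟧ G₄ (ε ▷ (a₁ , a₂))
¬P₄-hardOS-01 = ¬hardOS {c = a₀} {d = a₂} P₄-indist (λ ()) refl (λ ()) P₄-terminal

hardOS-nonMonotone : (Q₄ ⊆ₚ P₄) × ¬ (hardOS Q₄ ⊆ₚ hardOS P₄)
hardOS-nonMonotone =
  without-⊆ₚ ,
  ¬⊆ₚ-witness (snoc (snoc nil ((λ ()) , refl , Q₄-hardOS-12)) ((λ ()) , refl , Q₄-hardOS-01))
              ¬P₄-hardOS-01

proposition34 :
    (Σ ℕ λ n → Σ (Protocol n) λ P → Σ (Protocol n) λ Q →
       (Q ⊆ₚ P) × ¬ (hardLA Q ⊆ₚ hardLA P))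
    ×
    (Σ ℕ λ n → Σ (Protocol n) λ P → Σ (Protocol n) λ Q →
       (Q ⊆ₚ P) × ¬ (hardOS Q ⊆ₚ hardOS P))
proposition34 = (2 , callAlways , learnNewSecrets , hardLA-nonMonotone)
              , (4 , P₄ , Q₄ , hardOS-nonMonotone)
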